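{- Let $\Delta\ge3$ be an integer. If $G$ is a finite simple $3$-degenerate graph with maximum degree $\Delta(G)\le\Delta$ and $G$ contains no copy of $K_{3,\Delta}$, then $q_B(G)\le3\Delta-2$.
   Context: A $B$-coloring of a graph $G$ is a proper edge-coloring (incident edges receive distinct colors) in which the edges of every $4$-cycle receive four distinct colors; $q_B(G)$ is the minimum number of colors in a $B$-coloring of $G$. A graph is $d$-degenerate if every nonempty subgraph has a vertex of degree at most $d$ (in that subgraph). "Contains a copy of $K_{a,b}$" means contains a subgraph, not necessarily induced, isomorphic to the complete bipartite graph $K_{a,b}$. $\Delta(G)$ denotes the maximum degree of $G$. -}

module Defs where

open import Data.Bool.Base using (Bool; true; false; T; _xor_)
open import Data.Empty using (⊥-elim)
open import Data.Fin.Base using (Fin; zero; suc; splitAt; combine)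
open import Data.Fin.Properties using (any?; all?; _≟_; _<?_; <-asym; <-cmp; combine-injective)
open import Data.Fin.Subset using (Subset; _∈_; Nonempty; ∣_∣)
open import Data.List.Base using (List; []; _∷_; map; allFin)
open import Data.List.Extrema.Nat using (max)
open import Data.List.Relation.Unary.All using ([]; _∷_)
open import Data.List.Relation.Unary.AllPairs using ([]; _∷_)
open import Data.List.Relation.Unary.Unique.Propositional using (Unique)
open import Data.Nat.Base using (ℕ; zero; suc; _+_; _*_; _≤_; z≤n; s≤s)
open import Data.Product.Base using (∃; ∃-syntax; _×_; _,_; proj₁; proj₂)
open import Data.Sum.Base using (_⊎_; inj₁; inj₂; [_,_]′)
open import Data.Vec.Base using (tabulate)
open import Function.Base using (_∘_; const)
open import Function.Definitions using (Injective)
open import Relation.Binary.Core using (Rel)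
open import Relation.Binary.Definitions using (Reflexive; tri<; tri≈; tri>)
open import Relation.Binary.PropositionalEquality
open import Relation.Nullary using (¬_; Dec; yes; no)
open import Relation.Nullary.Decidable using (map′; ¬?; _×-dec_; _→-dec_)
open import Relation.Unary using (Pred; Decidable)
import Data.List.Relation.Unary.Unique.DecPropositional as DecUnique
open import Level using (0ℓ)

private
  variable
    n k : ℕ

record Graph (n : ℕ) : Set where
  field
    adj      : Fin n → Fin n → Bool
    adj-sym  : ∀ u v → adj u v ≡ adj v u
    loopless : ∀ u → adj u u ≡ false

  infix 4 _~_
  _~_ : Fin n → Fin n → Set
  u ~ v = T (adj u v)

  degree : Fin n → ℕ
  degree v = ∣ tabulate (adj v) ∣

  maxDegree : ℕ
  maxDegree = max 0 (map degree (allFin n))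

-- Subgraphs need not be induced.  Looplessness is inherited from the
-- ambient graph.
record Subgraph (G : Graph n) : Set where
  field
    vertices  : Subset n
    adj       : Fin n → Fin n → Bool
    adj-sym   : ∀ u v → adj u v ≡ adj v u
    adj⇒~     : ∀ u v → T (adj u v) → Graph._~_ G u v
    endpoints : ∀ u v → T (adj u v) → u ∈ vertices × v ∈ vertices

  degree : Fin n → ℕ
  degree v = ∣ tabulate (adj v) ∣

Degenerate : ℕ → Graph n → Set
Degenerate d G = (H : Subgraph G) → let open Subgraph H in
  Nonempty vertices → ∃[ v ] v ∈ vertices × degree v ≤ d

-- The image of an injective adjacency-preserving map, with the images of
-- the edges of H, is exactly a (not necessarily induced) subgraph of G
-- isomorphic to H.
ContainsCopy : ∀ {m n} → Graph m → Graph n → Set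
ContainsCopy {m} {n} H G = ∃[ f ] Injective {A = Fin m} {B = Fin n} _≡_ _≡_ f ×
  (∀ u v → Graph._~_ H u v → Graph._~_ G (f u) (f v))

private
  xor-comm : ∀ x y → x xor y ≡ y xor x
  xor-comm false false = refl
  xor-comm false true  = refl
  xor-comm true  false = refl
  xor-comm true  true  = refl

  xor-same : ∀ x → x xor x ≡ false
  xor-same false = refl
  xor-same true  = refl

-- The parts are the first a and the last b elements of Fin (a + b).
completeBipartite : (a b : ℕ) → Graph (a + b)
completeBipartite a b = record
  { adj      = λ u v → left u xor left v
  ; adj-sym  = λ u v → xor-comm (left u) (left v)
  ; loopless = λ u → xor-same (left u)
  }
  where
  left : Fin (a + b) → Bool
  left = [ const true , const false ]′ ∘ splitAt a

-- Only edges are assigned a color, so an edgeless graph can be colored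
-- with 0 colors.
EdgeMap : Graph n → ℕ → Set
EdgeMap G k = ∀ u v → Graph._~_ G u v → Fin k

-- The equation colour-sym makes a colour a function of the undirected edge.
record IsBColoring (G : Graph n) (colour : EdgeMap G k) : Set where
  open Graph G
  field
    colour-sym : ∀ u v (uv : u ~ v) (vu : v ~ u) → colour u v uv ≡ colour v u vu
    proper     : ∀ u v w (uv : u ~ v) (uw : u ~ w) → v ≢ w →
                 colour u v uv ≢ colour u w uw
    four-cycle : ∀ a b c d (ab : a ~ b) (bc : b ~ c) (cd : c ~ d) (da : d ~ a) →
                 Unique (a ∷ b ∷ c ∷ d ∷ []) →
                 Unique (colour a b ab ∷ colour b c bc ∷ colour c d cd ∷ colour d a da ∷ [])

BColorable : Graph n → ℕ → Set
BColorable G k = ∃[ colour ] IsBColoring {k = k} G colour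

IsMinimum : Pred ℕ 0ℓ → Pred ℕ 0ℓ
IsMinimum P m = P m × (∀ j → P j → m ≤ j)

private
  -- Search is relative to a relation because functions are only
  -- enumerated up to pointwise equality.
  Searchable : (A : Set) → Rel A 0ℓ → Set₁
  Searchable A _≈_ = {P : Pred A 0ℓ} → (∀ {x y} → x ≈ y → P x → P y) →
                     Decidable P → Dec (∃ P)

  search-Fin : Searchable (Fin k) _≡_
  search-Fin _ P? = any? P?

  search-T : ∀ {A : Set} {_≈_ : Rel A 0ℓ} → Searchable A _≈_ → ∀ b →
             Searchable (T b → A) (λ f g → ∀ t → f t ≈ g t)
  search-T S true  resp P? = map′ (λ (a , p) → _ , p) (λ (f , p) → f _ , p)
    (S (λ x≈y → resp (λ _ → x≈y)) (λ a → P? (λ _ → a)))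
  search-T S false resp P? = map′ (λ p → _ , p) (λ (f , p) → resp (λ ()) p) (P? (λ ()))

  search-Π : ∀ n {A : Fin n → Set} {_≈_ : ∀ i → Rel (A i) 0ℓ} →
             (∀ i → Reflexive (_≈_ i)) → (∀ i → Searchable (A i) (_≈_ i)) →
             Searchable (∀ i → A i) (λ f g → ∀ i → _≈_ i (f i) (g i))
  search-Π zero    _  _ resp P? =
    map′ (λ p → _ , p) (λ (f , p) → resp (λ ()) p) (P? (λ ()))
  search-Π (suc n) {A} {_≈_} rfl S {P} resp P? = map′
    (λ (a , f , p) → cons a f , p)
    (λ (f , p) → f zero , f ∘ suc , resp (λ { zero → rfl zero ; (suc i) → rfl (suc i) }) p)
    (S zero
      (λ x≈y (f , p) → f , resp (λ { zero → x≈y ; (suc i) → rfl (suc i) }) p)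
      (λ a → search-Π n (rfl ∘ suc) (S ∘ suc)
        (λ f≈g → resp (λ { zero → rfl zero ; (suc i) → f≈g i }))
        (λ f → P? (cons a f))))
    where
    cons : A zero → (∀ i → A (suc i)) → ∀ i → A i
    cons a f zero    = a
    cons a f (suc i) = f i

  T-all? : ∀ b {P : T b → Set} → Decidable P → Dec (∀ t → P t)
  T-all? true  P? = map′ (λ p _ → p) (λ f → f _) (P? _)
  T-all? false P? = yes (λ ())

module _ (G : Graph n) where
  open Graph G

  private
    isBColoring? : (colour : EdgeMap G k) → Dec (IsBColoring G colour)
    isBColoring? {k} colour = map′
      (λ (s , p , f) → record { colour-sym = s ; proper = p ; four-cycle = f })
      (λ B → let open IsBColoring B in colour-sym , proper , four-cycle)
      ( (all? λ u → all? λ v → T-all? (adj u v) λ uv → T-all? (adj v u) λ vu →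
           colour u v uv ≟ colour v u vu)
      ×-dec
        (all? λ u → all? λ v → all? λ w → T-all? (adj u v) λ uv → T-all? (adj u w) λ uw →
           ¬? (v ≟ w) →-dec ¬? (colour u v uv ≟ colour u w uw))
      ×-dec
        (all? λ a → all? λ b → all? λ c → all? λ d →
           T-all? (adj a b) λ ab → T-all? (adj b c) λ bc →
           T-all? (adj c d) λ cd → T-all? (adj d a) λ da →
           DecUnique.unique? _≟_ (a ∷ b ∷ c ∷ d ∷ []) →-dec
           DecUnique.unique? _≟_
             (colour a b ab ∷ colour b c bc ∷ colour c d cd ∷ colour d a da ∷ [])))

    isBColoring-resp : {f g : EdgeMap G k} → (∀ u v uv → f u v uv ≡ g u v uv) →
                       IsBColoring G f → IsBColoring G g
    isBColoring-resp f≗g B = record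
      { colour-sym = λ u v uv vu →
          trans (sym (f≗g u v uv)) (trans (colour-sym u v uv vu) (f≗g v u vu))
      ; proper     = λ u v w uv uw v≢w →
          subst₂ _≢_ (f≗g u v uv) (f≗g u w uw) (proper u v w uv uw v≢w)
      ; four-cycle = λ a b c d ab bc cd da distinct →
          subst Unique
            (cong₂ _∷_ (f≗g a b ab) (cong₂ _∷_ (f≗g b c bc)
              (cong₂ _∷_ (f≗g c d cd) (cong (_∷ []) (f≗g d a da)))))
            (four-cycle a b c d ab bc cd da distinct)
      }
      where open IsBColoring B

  bColorable? : Decidable (BColorable G)
  bColorable? k =
    search-Π n (λ _ _ _ → refl) (λ u →
      search-Π n (λ _ _ → refl) (λ v → search-T search-Fin (adj u v)))
    isBColoring-resp isBColoring?

private
  pair : Fin n → Fin n → Fin (n * n)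
  pair u v with u <? v
  ... | yes _ = combine u v
  ... | no  _ = combine v u

  pair-sym : (u v : Fin n) → pair u v ≡ pair v u
  pair-sym u v with u <? v | v <? u | <-cmp u v
  ... | yes p | yes q | _            = ⊥-elim (<-asym p q)
  ... | yes _ | no  _ | _            = refl
  ... | no  _ | yes _ | _            = refl
  ... | no ¬p | no  _ | tri< p _ _   = ⊥-elim (¬p p)
  ... | no  _ | no  _ | tri≈ _ refl _ = refl
  ... | no  _ | no ¬q | tri> _ _ q   = ⊥-elim (¬q q)

  pair-injective : (u v x y : Fin n) → pair u v ≡ pair x y →
                   (u ≡ x × v ≡ y) ⊎ (u ≡ y × v ≡ x)
  pair-injective u v x y eq with u <? v | x <? y
  ... | yes _ | yes _ = inj₁ (combine-injective u v x y eq)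
  ... | yes _ | no  _ = inj₂ (combine-injective u v y x eq)
  ... | no  _ | yes _ = let p , q = combine-injective v u x y eq in inj₂ (q , p)
  ... | no  _ | no  _ = let p , q = combine-injective v u y x eq in inj₁ (q , p)

  pair-≢ : (u v x y : Fin n) → u ≢ x ⊎ v ≢ y → u ≢ y ⊎ v ≢ x → pair u v ≢ pair x y
  pair-≢ u v x y h₁ h₂ eq with pair-injective u v x y eq
  pair-≢ u v x y (inj₁ h) _ _ | inj₁ (p , _) = h p
  pair-≢ u v x y (inj₂ h) _ _ | inj₁ (_ , q) = h q
  pair-≢ u v x y _ (inj₁ h) _ | inj₂ (p , _) = h p
  pair-≢ u v x y _ (inj₂ h) _ | inj₂ (_ , q) = h q

-- Every edge receives its own color.
bColorable-n*n : (G : Graph n) → BColorable G (n * n)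
bColorable-n*n G = (λ u v _ → pair u v) , record
  { colour-sym = λ u v _ _ → pair-sym u v
  ; proper     = λ u v w _ uw v≢w → pair-≢ u v u w (inj₂ v≢w) (inj₁ (~⇒≢ u w uw))
  ; four-cycle = λ where
      a b c d _ _ _ _ ((a≢b ∷ a≢c ∷ a≢d ∷ []) ∷ (b≢c ∷ b≢d ∷ []) ∷ (c≢d ∷ []) ∷ [] ∷ []) →
        (pair-≢ a b b c (inj₁ a≢b) (inj₁ a≢c) ∷
         pair-≢ a b c d (inj₁ a≢c) (inj₁ a≢d) ∷
         pair-≢ a b d a (inj₁ a≢d) (inj₂ b≢d) ∷ []) ∷
        (pair-≢ b c c d (inj₁ b≢c) (inj₁ b≢d) ∷
         pair-≢ b c d a (inj₁ b≢d) (inj₁ (a≢b ∘ sym)) ∷ []) ∷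
        (pair-≢ c d d a (inj₁ c≢d) (inj₁ (a≢c ∘ sym)) ∷ []) ∷ [] ∷ []
  }
  where
  open Graph G
  ~⇒≢ : ∀ u v → u ~ v → u ≢ v
  ~⇒≢ u v uv refl = subst T (loopless u) uv

private
  minimum : {P : Pred ℕ 0ℓ} → Decidable P → ∀ m → P m → ∃ (IsMinimum P)
  minimum P? m pm with P? 0
  ... | yes p0 = 0 , p0 , λ _ _ → z≤n
  minimum P? zero    pm | no ¬p0 = ⊥-elim (¬p0 pm)
  minimum P? (suc m) pm | no ¬p0 with minimum (P? ∘ suc) m pm
  ... | q , pq , least = suc q , pq , λ where
    zero    p → ⊥-elim (¬p0 p)
    (suc j) p → s≤s (least j p)

  bIndex : (G : Graph n) → ∃ (IsMinimum (BColorable G))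
  bIndex {n} G = minimum (bColorable? G) (n * n) (bColorable-n*n G)

qB : Graph n → ℕ
qB G = proj₁ (bIndex G)

qB-isMinimum : (G : Graph n) → IsMinimum (BColorable G) (qB G)
qB-isMinimum G = proj₂ (bIndex G)

{-# OPTIONS --safe #-}
-- Remove a vertex v of degree at most 3, colour the rest inductively, and then
-- colour the edges from v to its neighbours one at a time.  The edge vu must
-- avoid the colours of the edges wx with w a neighbour of v (possibly u itself)
-- and x ≢ v a common neighbour of u and w, and the colours already given at v.
-- Each w contributes at most Δ − 1 colours, and Δ − 1 is attained by at most one
-- pair u ≢ w, as two such pairs sharing u give a K_{3,Δ} on N(u).  Colouring
-- last an edge vu with u in no such pair, greedy choice needs 3Δ − 2 colours.
module Submission where

open import Defs
open import Data.Bool.Base using (Bool; true; false; T; _∧_)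
open import Data.Bool.Properties using (T?; T-∧; T-≡; ∧-comm)
open import Data.Empty using (⊥-elim)
open import Data.Fin.Base using (Fin; zero; suc; splitAt; inject≤; _↑ˡ_; _↑ʳ_)
open import Data.Fin.Properties using (_≟_; injective⇒≤; inject≤-injective; splitAt⁻¹-↑ˡ; splitAt⁻¹-↑ʳ)
open import Data.Fin.Subset as Subset using (Subset; ∣_∣; _⊂_)
open import Data.Fin.Subset.Induction using (⊂-wellFounded)
open import Data.Fin.Subset.Properties using (∈⊤; nonempty?; x∈p∧x≢y⇒x∈p-y; x∈p⇒p-x⊂p)
open import Data.List.Base as List using (List; []; _∷_; _++_; map; filter; concatMap; length; lookup; allFin)
open import Data.List.Extrema.Nat using (xs≤max)
open import Data.List.Membership.Propositional using (_∈_; _∉_; lose)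
open import Data.List.Membership.Propositional.Properties
  using (∈-lookup; ∈-allFin; ∈-filter⁺; ∈-filter⁻; ∈-map⁺; ∈-++⁺ˡ; ∈-++⁺ʳ; ∈-concatMap⁺)
open import Data.List.Properties using (length-map; length-++; length-tabulate)
open import Data.List.Relation.Binary.Subset.Propositional using (_⊆_)
open import Data.List.Relation.Unary.All as All using (All; []; _∷_)
open import Data.List.Relation.Unary.All.Properties using (¬Any⇒All¬)
open import Data.List.Relation.Unary.AllPairs using ([]; _∷_)
open import Data.List.Relation.Unary.Any as Any using (here; there; index; any?)
open import Data.List.Relation.Unary.Any.Properties using (lookup-index)
open import Data.List.Relation.Unary.Unique.Propositional using (Unique)
open import Data.List.Relation.Unary.Unique.Propositional.Properties using (allFin⁺; filter⁺)
open import Data.Nat.Base using (ℕ; zero; suc; _+_; _≤_; _<_; _*_; _∸_; z≤n; s≤s; s≤s⁻¹)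
open import Data.Nat.ListAction using (sum)
open import Data.Nat.Properties
  using (≤-trans; ≤-reflexive; <-irrefl; _≤?_; ≰⇒>; +-mono-≤; +-monoˡ-≤; m+n≤o⇒m≤o)
open import Data.Nat.Tactic.RingSolver using (solve-∀)
open import Data.Product.Base using (∃-syntax; _×_; _,_; proj₁; proj₂)
open import Data.Sum.Base using (_⊎_; inj₁; inj₂; [_,_]′)
open import Data.Unit.Base using (⊤; tt)
import Data.Vec.Base as Vec
open import Data.Vec.Properties using ([]=⇒lookup; lookup⇒[]=)
open import Function.Base using (_∘_; id)
open import Function.Bundles using (Equivalence)
open import Function.Definitions using (Injective)
open import Induction.WellFounded using (Acc; acc)
open import Relation.Binary.PropositionalEquality
open import Relation.Nullary using (¬_; yes; no)
open import Relation.Nullary.Decidable using (¬?; _×-dec_)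

private
  variable
    n k : ℕ

-- Counting with duplicate-free lists.

lookup-injective : ∀ {A : Set} {xs : List A} → Unique xs → Injective _≡_ _≡_ (lookup xs)
lookup-injective (_   ∷ _) {zero}  {zero}  _  = refl
lookup-injective (x∉ ∷ _) {zero}  {suc j} eq = ⊥-elim (All.lookup x∉ (∈-lookup j) eq)
lookup-injective (x∉ ∷ _) {suc i} {zero}  eq = ⊥-elim (All.lookup x∉ (∈-lookup i) (sym eq))
lookup-injective (_   ∷ u) {suc i} {suc j} eq = cong suc (lookup-injective u eq)

-- Pigeonhole: sending an index of `xs` to a position of the same entry in `ys` is injective, since
-- `xs` has no repetitions.
unique-⊆⇒length-≤ : ∀ {A : Set} {xs ys : List A} → Unique xs → xs ⊆ ys → length xs ≤ length ys
unique-⊆⇒length-≤ {xs = xs} {ys} u xs⊆ys = injective⇒≤ {f = position} λ {i} {j} eq →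
  lookup-injective u (begin
    lookup xs i             ≡⟨ lookup-index (xs⊆ys (∈-lookup i)) ⟩
    lookup ys (position i)  ≡⟨ cong (lookup ys) eq ⟩
    lookup ys (position j)  ≡⟨ lookup-index (xs⊆ys (∈-lookup j)) ⟨
    lookup xs j             ∎)
  where
  open ≡-Reasoning
  position : Fin (length xs) → Fin (length ys)
  position i = index (xs⊆ys (∈-lookup i))

unique-⊆-length-≥⇒⊇ : {xs ys : List (Fin n)} → Unique xs → xs ⊆ ys →
                      length ys ≤ length xs → ys ⊆ xs
unique-⊆-length-≥⇒⊇ {xs = xs} u xs⊆ys ys≤xs {y} y∈ys with any? (y ≟_) xs
... | yes y∈xs = y∈xs
-- Otherwise `y ∷ xs` is still duplicate-free and inside `ys`, but too long.
... | no  y∉xs = ⊥-elim (<-irrefl refl (≤-trans (unique-⊆⇒length-≤ (¬Any⇒All¬ xs y∉xs ∷ u) λ where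
  (here refl) → y∈ys
  (there x∈)  → xs⊆ys x∈) ys≤xs))

-- Greedy choice of colours.

fresh : (xs : List (Fin k)) → length xs < k → ∃[ c ] c ∉ xs
fresh {k} xs short with any? (λ c → ¬? (any? (c ≟_) xs)) (allFin k)
... | yes p = _ , proj₂ (Any.satisfied p)
... | no ¬p = ⊥-elim (<-irrefl refl (≤-trans short (subst (_≤ length xs) (length-tabulate id)
  (unique-⊆⇒length-≤ (allFin⁺ k) all-in))))
  where
  all-in : allFin k ⊆ xs
  all-in {c} c∈ with any? (c ≟_) xs
  ... | yes c∈xs = c∈xs
  ... | no  c∉xs = ⊥-elim (¬p (lose c∈ c∉xs))

-- The entries are treated from right to left, so an entry must avoid its own
-- forbidden colours and the colours of the entries after it.
Greedy : ∀ {A : Set} (k : ℕ) → (A → List (Fin k)) → List A → Set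
Greedy k forbidden []       = ⊤
Greedy k forbidden (x ∷ xs) =
  length (forbidden x) + length xs < k × Greedy k forbidden xs

greedy-colours : (forbidden : Fin n → List (Fin (suc k))) (xs : List (Fin n)) →
  Unique xs → Greedy (suc k) forbidden xs →
  ∃[ g ] (∀ {x} → x ∈ xs → g x ∉ forbidden x) ×
         (∀ {x y} → x ∈ xs → y ∈ xs → x ≢ y → g x ≢ g y)
-- `g` is total, so it needs a default value outside the list; this is why the number of colours is
-- a successor.
greedy-colours forbidden [] _ _ = (λ _ → zero) , (λ ()) , (λ ())
greedy-colours {n} {k} forbidden (a ∷ xs) (a∉ ∷ u) (room , rest)
  with g , avoids , inj ← greedy-colours forbidden xs u rest
  with c , c∉ ← fresh (forbidden a ++ map g xs)
         (subst (_< suc k) (sym (trans (length-++ (forbidden a))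
           (cong (length (forbidden a) +_) (length-map g xs)))) room)
  = g′ , avoids′ , inj′
  where
  g′ : Fin n → Fin (suc k)
  g′ x with x ≟ a
  ... | yes _ = c
  ... | no  _ = g x

  c≢ : ∀ {x} → x ∈ xs → c ≢ g x
  c≢ x∈ refl = c∉ (∈-++⁺ʳ (forbidden a) (∈-map⁺ g x∈))

  tail : ∀ {x} → x ∈ a ∷ xs → x ≢ a → x ∈ xs
  tail (here x≡a) x≢a = ⊥-elim (x≢a x≡a)
  tail (there x∈) _   = x∈

  avoids′ : ∀ {x} → x ∈ a ∷ xs → g′ x ∉ forbidden x
  avoids′ {x} x∈ with x ≟ a
  ... | yes refl = c∉ ∘ ∈-++⁺ˡ
  ... | no  x≢a  = avoids (tail x∈ x≢a)

  inj′ : ∀ {x y} → x ∈ a ∷ xs → y ∈ a ∷ xs → x ≢ y → g′ x ≢ g′ y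
  inj′ {x} {y} x∈ y∈ x≢y with x ≟ a | y ≟ a
  ... | yes refl | yes refl = ⊥-elim (x≢y refl)
  ... | yes refl | no  y≢a  = c≢ (tail y∈ y≢a)
  ... | no  x≢a  | yes refl = c≢ (tail x∈ x≢a) ∘ sym
  ... | no  x≢a  | no  y≢a  = inj (tail x∈ x≢a) (tail y∈ y≢a) x≢y

-- Neighbour lists, common neighbours and induced subgraphs.

-- Links neighbour lists with degrees, which are cardinalities of subsets. The map `g` is general
-- for the sake of the induction; `g = id` is the case used.
length-filter-tabulate : ∀ {m} (f : Fin n → Bool) (g : Fin m → Fin n) →
  length (filter (T? ∘ f) (List.tabulate g)) ≡ ∣ Vec.tabulate (f ∘ g) ∣
length-filter-tabulate {m = zero}  f g = refl
length-filter-tabulate {m = suc m} f g with f (g zero)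
... | true  = cong suc (length-filter-tabulate f (g ∘ suc))
... | false = length-filter-tabulate f (g ∘ suc)

module _ (G : Graph n) where
  open Graph G

  neighbours : Fin n → List (Fin n)
  neighbours u = filter (T? ∘ adj u) (allFin n)

  commonExcept : (v u w : Fin n) → List (Fin n)
  commonExcept v u w =
    filter (λ x → T? (adj u x) ×-dec T? (adj w x) ×-dec ¬? (x ≟ v)) (allFin n)

  induced : Subset n → Subgraph G
  induced S = record
    { vertices  = S
    ; adj       = λ u v → (inS u ∧ inS v) ∧ adj u v
    ; adj-sym   = λ u v → cong₂ _∧_ (∧-comm (inS u) (inS v)) (adj-sym u v)
    ; adj⇒~     = λ u v → proj₂ ∘ to T-∧
    ; endpoints = λ u v t → let p , q = to T-∧ (proj₁ (to T-∧ t)) in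
                            T⇒∈ u p , T⇒∈ v q
    }
    where
    open Equivalence
    inS : Fin n → Bool
    inS = Vec.lookup S
    T⇒∈ : ∀ u → T (inS u) → u Subset.∈ S
    T⇒∈ u t = lookup⇒[]= u S (to T-≡ t)

  private
    ~-sym : ∀ {u v} → u ~ v → v ~ u
    ~-sym {u} {v} = subst T (adj-sym u v)

    ~⇒≢ : ∀ {u v} → u ~ v → u ≢ v
    ~⇒≢ {u} uv refl = subst T (loopless u) uv

    ∈-neighbours : ∀ {u x} → u ~ x → x ∈ neighbours u
    ∈-neighbours {u} {x} = ∈-filter⁺ (T? ∘ adj u) (∈-allFin x)

    neighbours-∈ : ∀ {u x} → x ∈ neighbours u → u ~ x
    neighbours-∈ {u} x∈ = proj₂ (∈-filter⁻ (T? ∘ adj u) {xs = allFin n} x∈)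

    ∈-commonExcept : ∀ {v u w x} → u ~ x → w ~ x → x ≢ v → x ∈ commonExcept v u w
    ∈-commonExcept ux wx x≢v = ∈-filter⁺ _ (∈-allFin _) (ux , wx , x≢v)

    commonExcept-∈ : ∀ {v u w x} → x ∈ commonExcept v u w → u ~ x × w ~ x × x ≢ v
    commonExcept-∈ x∈ = proj₂ (∈-filter⁻ _ {xs = allFin n} x∈)

    commonExcept-unique : ∀ v u w → Unique (commonExcept v u w)
    commonExcept-unique v u w = filter⁺ _ (allFin⁺ n)

    v∷commonExcept-unique : ∀ v u w → Unique (v ∷ commonExcept v u w)
    v∷commonExcept-unique v u w =
      All.tabulate (λ x∈ v≡x → proj₂ (proj₂ (commonExcept-∈ {v} {u} {w} x∈)) (sym v≡x))
      ∷ commonExcept-unique v u w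

    v∷commonExcept⊆ : ∀ {v u w} → u ~ v → v ∷ commonExcept v u w ⊆ neighbours u
    v∷commonExcept⊆ uv (here refl) = ∈-neighbours uv
    v∷commonExcept⊆ {v} {u} {w} _  (there x∈)  =
      ∈-neighbours (proj₁ (commonExcept-∈ {v} {u} {w} x∈))

    degree≤maxDegree : ∀ u → degree u ≤ maxDegree
    degree≤maxDegree u = All.lookup (xs≤max 0 _) (∈-map⁺ degree (∈-allFin u))

    length-neighbours : ∀ u → length (neighbours u) ≤ maxDegree
    length-neighbours u = subst (_≤ maxDegree)
      (sym (length-filter-tabulate (adj u) id)) (degree≤maxDegree u)

    commonExcept-length-comm : ∀ v u w →
      length (commonExcept v u w) ≤ length (commonExcept v w u)
    commonExcept-length-comm v u w = unique-⊆⇒length-≤ (commonExcept-unique v u w) λ x∈ →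
      let ux , wx , x≢v = commonExcept-∈ {v} {u} {w} x∈ in ∈-commonExcept wx ux x≢v

  -- Recognising a copy of K_{3,Δ}.

  containsCopy-K₃ : ∀ {Δ u v w} (xs : List (Fin n)) → u ≢ v → u ≢ w → v ≢ w →
    Unique xs → Δ ≤ length xs →
    (∀ {x} → x ∈ xs → u ~ x × v ~ x × w ~ x) →
    ContainsCopy (completeBipartite 3 Δ) G
  containsCopy-K₃ {Δ} {u} {v} {w} xs u≢v u≢w v≢w uniq Δ≤ adjacent =
    f , f-injective , f-adj
    where
    p : Fin 3 → Fin n
    p = lookup (u ∷ v ∷ w ∷ [])

    q : Fin Δ → Fin n
    q j = lookup xs (inject≤ j Δ≤)

    p~q : ∀ i j → p i ~ q j
    p~q i j with adjacent (∈-lookup {xs = xs} (inject≤ j Δ≤))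
    p~q zero             j | a , _ , _ = a
    p~q (suc zero)       j | _ , b , _ = b
    p~q (suc (suc zero)) j | _ , _ , c = c

    p-injective : ∀ {i j} → p i ≡ p j → i ≡ j
    p-injective = lookup-injective
      ((u≢v ∷ u≢w ∷ []) ∷ (v≢w ∷ []) ∷ [] ∷ [])

    q-injective : ∀ {i j} → q i ≡ q j → i ≡ j
    q-injective eq = inject≤-injective Δ≤ Δ≤ _ _ (lookup-injective uniq eq)

    f : Fin (3 + Δ) → Fin n
    f = [ p , q ]′ ∘ splitAt 3

    f-injective : Injective _≡_ _≡_ f
    f-injective {x} {y} eq with splitAt 3 x in ex | splitAt 3 y in ey
    ... | inj₁ i | inj₁ j = trans (sym (splitAt⁻¹-↑ˡ ex))
          (trans (cong (_↑ˡ Δ) (p-injective eq)) (splitAt⁻¹-↑ˡ ey))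
    -- Images from different parts are adjacent, hence distinct.
    ... | inj₁ i | inj₂ j = ⊥-elim (~⇒≢ (p~q i j) eq)
    ... | inj₂ i | inj₁ j = ⊥-elim (~⇒≢ (p~q j i) (sym eq))
    ... | inj₂ i | inj₂ j = trans (sym (splitAt⁻¹-↑ʳ {m = 3} ex))
          (trans (cong (3 ↑ʳ_) (q-injective eq)) (splitAt⁻¹-↑ʳ {m = 3} ey))

    f-adj : ∀ x y → Graph._~_ (completeBipartite 3 Δ) x y → f x ~ f y
    -- For two vertices of one part, `xy` has type `T false`, so only the mixed cases remain.
    f-adj x y xy with splitAt 3 x | splitAt 3 y
    ... | inj₁ i | inj₂ j = p~q i j
    ... | inj₂ i | inj₁ j = ~-sym (p~q j i)

  -- B-colourings of induced subgraphs.

  -- `col` is defined on all pairs of vertices, so the same type serves every `S`; its values off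
  -- the edges inside `S` carry no meaning. Consecutive edges of a 4-cycle are handled by `proper`,
  -- so `opposite` treats only the other pairs.
  record GoodOn (S : Subset n) (col : Fin n → Fin n → Fin k) : Set where
    field
      symmetric : ∀ u w → col u w ≡ col w u
      proper    : ∀ {u x y} → u Subset.∈ S → x Subset.∈ S → y Subset.∈ S →
                  u ~ x → u ~ y → x ≢ y → col u x ≢ col u y
      opposite  : ∀ {a b c d} → a Subset.∈ S → b Subset.∈ S → c Subset.∈ S → d Subset.∈ S →
                  a ~ b → b ~ c → c ~ d → d ~ a → a ≢ c → b ≢ d → col a b ≢ col c d

  -- Of the six pairs of edges in a 4-cycle, four are incident and two are opposite.
  goodOn-⊤⇒bColorable : ∀ {col : Fin n → Fin n → Fin k} → GoodOn Subset.⊤ col → BColorable G k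
  goodOn-⊤⇒bColorable {col = col} good = (λ u v _ → col u v) , record
    { colour-sym = λ u v _ _ → symmetric u v
    ; proper     = λ u v w → proper ∈⊤ ∈⊤ ∈⊤
    ; four-cycle = λ where
        a b c d ab bc cd da ((_ ∷ a≢c ∷ _ ∷ []) ∷ (_ ∷ b≢d ∷ []) ∷ _) →
          (adjacent ab bc a≢c ∷ opposite ∈⊤ ∈⊤ ∈⊤ ∈⊤ ab bc cd da a≢c b≢d ∷
             (adjacent da ab (b≢d ∘ sym) ∘ sym) ∷ []) ∷
          (adjacent bc cd b≢d ∷ opposite ∈⊤ ∈⊤ ∈⊤ ∈⊤ bc cd da ab b≢d (a≢c ∘ sym) ∷ []) ∷
          (adjacent cd da (a≢c ∘ sym) ∷ []) ∷ [] ∷ []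
    }
    where
    open GoodOn good
    adjacent : ∀ {x y z} → x ~ y → y ~ z → x ≢ z → col x y ≢ col y z
    adjacent {x} {y} xy yz x≢z eq =
      proper ∈⊤ ∈⊤ ∈⊤ (~-sym xy) yz x≢z (trans (symmetric y x) eq)

  -- Extending a colouring by the edges at one vertex.

  -- `g u` is the intended colour of the edge `v u`. In `avoids`, `w = u` concerns the other edges
  -- at `u`, and `w ≢ u` concerns the edge opposite to `v u` in the 4-cycle `v u x w`.
  record StarColours (v : Fin n) (N : List (Fin n)) (col : Fin n → Fin n → Fin k) : Set where
    field
      g           : Fin n → Fin k
      avoids      : ∀ {u w x} → u ∈ N → w ∈ N → u ~ x → w ~ x → x ≢ v → g u ≢ col w x
      g-injective : ∀ {x y} → x ∈ N → y ∈ N → x ≢ y → g x ≢ g y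

  -- Applied to rearrangements of a list: the conditions depend on membership alone, so the greedy
  -- order can be chosen freely.
  starColours-⊆ : ∀ {v N M} {col : Fin n → Fin n → Fin k} → N ⊆ M →
                  StarColours v M col → StarColours v N col
  starColours-⊆ N⊆M s = record
    { g           = g
    ; avoids      = λ u∈ w∈ → avoids (N⊆M u∈) (N⊆M w∈)
    ; g-injective = λ x∈ y∈ → g-injective (N⊆M x∈) (N⊆M y∈)
    }
    where open StarColours s

  module Extension (S : Subset n) (v : Fin n) (N : List (Fin n))
    (N-complete : ∀ {u} → u Subset.∈ S → v ~ u → u ∈ N)
    {k : ℕ} (col : Fin n → Fin n → Fin k)
    (good : GoodOn (S Subset.- v) col) (star : StarColours v N col) where
    open GoodOn good
    open StarColours star

    private
      extended : Fin n → Fin n → Fin k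
      extended u w with u ≟ v | w ≟ v
      ... | yes _ | _     = g w
      ... | no  _ | yes _ = g u
      ... | no  _ | no  _ = col u w

      extended-symmetric : ∀ u w → extended u w ≡ extended w u
      extended-symmetric u w with u ≟ v | w ≟ v
      ... | yes refl | yes refl = refl
      ... | yes _    | no  _    = refl
      ... | no  _    | yes _    = refl
      ... | no  _    | no  _    = symmetric u w

      extended-proper : ∀ {u x y} → u Subset.∈ S → x Subset.∈ S → y Subset.∈ S →
        u ~ x → u ~ y → x ≢ y → extended u x ≢ extended u y
      extended-proper {u} {x} {y} u∈ x∈ y∈ ux uy x≢y with u ≟ v | x ≟ v | y ≟ v
      ... | yes refl | _        | _        = g-injective (N-complete x∈ ux) (N-complete y∈ uy) x≢y
      ... | no  _    | yes refl | yes refl = ⊥-elim (x≢y refl)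
      ... | no  _    | yes refl | no  y≢v  =
        -- The case `w = u` of `avoids`.
        let u∈N = N-complete u∈ (~-sym ux) in avoids u∈N u∈N uy uy y≢v
      ... | no  _    | no  x≢v  | yes refl =
        let u∈N = N-complete u∈ (~-sym uy) in avoids u∈N u∈N ux ux x≢v ∘ sym
      ... | no  u≢v  | no  x≢v  | no  y≢v  =
        proper (x∈p∧x≢y⇒x∈p-y u∈ u≢v) (x∈p∧x≢y⇒x∈p-y x∈ x≢v) (x∈p∧x≢y⇒x∈p-y y∈ y≢v) ux uy x≢y

      -- The edge opposite to v b in a 4-cycle v b c d.
      g≢opposite : ∀ {b c d} → b Subset.∈ S → d Subset.∈ S →
        v ~ b → b ~ c → c ~ d → d ~ v → c ≢ v → g b ≢ col c d
      g≢opposite {b} {c} {d} b∈ d∈ vb bc cd dv c≢v eq =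
        avoids (N-complete b∈ vb) (N-complete d∈ (~-sym dv)) bc (~-sym cd) c≢v
          (trans eq (symmetric c d))

      extended-opposite : ∀ {a b c d} →
        a Subset.∈ S → b Subset.∈ S → c Subset.∈ S → d Subset.∈ S →
        a ~ b → b ~ c → c ~ d → d ~ a → a ≢ c → b ≢ d → extended a b ≢ extended c d
      extended-opposite {a} {b} {c} {d} a∈ b∈ c∈ d∈ ab bc cd da a≢c b≢d
        -- If exactly one vertex of the cycle is `v`, a rotation or reflection makes the cycle start
        -- there and `g≢opposite` applies. Two vertices equal to `v` contradict looplessness, `a≢c`
        -- or `b≢d`.
        with a ≟ v | b ≟ v | c ≟ v | d ≟ v
      ... | yes refl | _        | yes refl | _        = ⊥-elim (a≢c refl)
      ... | yes refl | _        | no  _    | yes refl = ⊥-elim (~⇒≢ da refl)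
      ... | yes refl | _        | no  c≢v  | no  _    = g≢opposite b∈ d∈ ab bc cd da c≢v
      ... | no  _    | yes refl | yes refl | _        = ⊥-elim (~⇒≢ bc refl)
      ... | no  _    | yes refl | no  _    | yes refl = ⊥-elim (b≢d refl)
      ... | no  _    | yes refl | no  _    | no  d≢v  = λ eq →
        g≢opposite a∈ c∈ (~-sym ab) (~-sym da) (~-sym cd) (~-sym bc) d≢v
          (trans eq (symmetric c d))
      ... | no  _    | no  b≢v  | yes refl | _        = λ eq →
        g≢opposite d∈ b∈ cd da ab bc a≢c (sym eq)
      ... | no  _    | no  b≢v  | no  _    | yes refl = λ eq →
        g≢opposite c∈ a∈ (~-sym cd) (~-sym bc) (~-sym ab) (~-sym da) b≢v
          (trans (sym eq) (symmetric a b))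
      ... | no  a≢v  | no  b≢v  | no  c≢v  | no  d≢v  =
        opposite (x∈p∧x≢y⇒x∈p-y a∈ a≢v) (x∈p∧x≢y⇒x∈p-y b∈ b≢v)
          (x∈p∧x≢y⇒x∈p-y c∈ c≢v) (x∈p∧x≢y⇒x∈p-y d∈ d≢v) ab bc cd da a≢c b≢d

    extension : ∃[ col′ ] GoodOn {k = k} S col′
    extension = extended , record
      { symmetric = extended-symmetric
      ; proper    = extended-proper
      ; opposite  = extended-opposite
      }

  -- Bounds on common neighbours.

  module _ (e : ℕ) (maxDegree≤Δ : maxDegree ≤ 3 + e)
    (K₃-free : ¬ ContainsCopy (completeBipartite 3 (3 + e)) G) where

    private
      Δ : ℕ
      Δ = 3 + e

      -- Neighbours u and w of v have at most Δ − 1 = 2 + e common neighbours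
      -- other than v; the pair is full when this is attained.
      NotFull : (v u w : Fin n) → Set
      NotFull v u w = length (commonExcept v u w) ≤ 1 + e

      notFull-sym : ∀ {v u w} → NotFull v u w → NotFull v w u
      notFull-sym {v} {u} {w} = ≤-trans (commonExcept-length-comm v w u)

      -- `v` is one further neighbour of `u`, so one is saved from the degree bound. The case
      -- `w = u` counts the other edges at `u`.
      length-commonExcept : ∀ {v u w} → u ~ v → length (commonExcept v u w) ≤ 2 + e
      length-commonExcept {v} {u} {w} uv = s≤s⁻¹ (≤-trans
        (unique-⊆⇒length-≤ (v∷commonExcept-unique v u w) (v∷commonExcept⊆ {w = w} uv))
        (≤-trans (length-neighbours u) maxDegree≤Δ))

      -- If both pairs are full, then N(u) = N(u) ∩ N(w) = N(u) ∩ N(w′) has Δ elements.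
      notFull⊎notFull : ∀ {v u w w′} → u ~ v → w ~ v → w′ ~ v → u ≢ w → u ≢ w′ → w ≢ w′ →
                        NotFull v u w ⊎ NotFull v u w′
      notFull⊎notFull {v} {u} {w} {w′} uv wv w′v u≢w u≢w′ w≢w′
        with length (commonExcept v u w) ≤? 1 + e | length (commonExcept v u w′) ≤? 1 + e
      ... | yes p | _     = inj₁ p
      ... | no  _ | yes q = inj₂ q
      ... | no ¬p | no ¬q = ⊥-elim (K₃-free (containsCopy-K₃ (v ∷ commonExcept v u w)
              u≢w u≢w′ w≢w′ (v∷commonExcept-unique v u w) (s≤s (≰⇒> ¬p)) λ where
                (here refl) → uv , wv , w′v
                (there x∈)  → let ux , wx , _ = commonExcept-∈ {v} {u} {w} x∈ in
                              ux , wx , neighbour′ (⊇ (∈-neighbours ux))))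
        where
        ⊇ : neighbours u ⊆ v ∷ commonExcept v u w′
        ⊇ = unique-⊆-length-≥⇒⊇ (v∷commonExcept-unique v u w′) (v∷commonExcept⊆ {w = w′} uv)
          (≤-trans (length-neighbours u) (≤-trans maxDegree≤Δ (s≤s (≰⇒> ¬q))))
        neighbour′ : ∀ {x} → x ∈ v ∷ commonExcept v u w′ → w′ ~ x
        neighbour′ (here refl) = w′v
        neighbour′ (there x∈)  = proj₁ (proj₂ (commonExcept-∈ {v} {u} {w′} x∈))

    -- Colouring the edges at a vertex with at most three neighbours.

    module _ (v : Fin n) (col : Fin n → Fin n → Fin (3 * Δ ∸ 2)) where

      -- With w = u this also forbids the colours of the other edges at u.
      forbidden : List (Fin n) → Fin n → List (Fin (3 * Δ ∸ 2))
      forbidden N u = concatMap (λ w → map (col w) (commonExcept v u w)) N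

      greedy-star : ∀ {N} → Unique N → Greedy (3 * Δ ∸ 2) (forbidden N) N → StarColours v N col
      greedy-star {N} uniq room with g , avoids , inj ← greedy-colours (forbidden N) N uniq room
        = record
        { g           = g
        ; avoids      = λ {u} {w} {x} u∈ w∈ ux wx x≢v eq → avoids u∈
            (∈-concatMap⁺ _ (lose w∈
              (subst (_∈ _) (sym eq) (∈-map⁺ (col w) (∈-commonExcept ux wx x≢v)))))
        ; g-injective = inj
        }

      private
        part : Fin n → Fin n → ℕ
        part u w = length (commonExcept v u w)

        length-forbidden : ∀ N u → length (forbidden N u) ≡ sum (map (part u) N)
        length-forbidden []      u = refl
        length-forbidden (w ∷ N) u = trans (length-++ (map (col w) (commonExcept v u w)))
          (cong₂ _+_ (length-map (col w) (commonExcept v u w)) (length-forbidden N u))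

        -- `j` counts the edges at `v` coloured before `v u`, and `r` is the number of spare
        -- colours. An equation with explicit slack is within reach of the ring solver.
        room : ∀ {j B} N u r → sum (map (part u) N) ≤ B → suc (B + j) + r ≡ 3 * Δ ∸ 2 →
               length (forbidden N u) + j < 3 * Δ ∸ 2
        room {j} N u r sum≤B eq = ≤-trans
          (s≤s (+-monoˡ-≤ j (≤-trans (≤-reflexive (length-forbidden N u)) sum≤B)))
          (m+n≤o⇒m≤o _ (≤-reflexive eq))

      star₁ : ∀ {a} → a ~ v → StarColours v (a ∷ []) col
      star₁ {a} av = greedy-star ([] ∷ [])
        ( room N a (4 + 2 * e) (+-mono-≤ (length-commonExcept av) z≤n) (arith e)
        , tt)
        where
        N = a ∷ []
        -- The right-hand side is what `3 * Δ ∸ 2` reduces to, free of truncated subtraction.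
        arith : ∀ e → suc (2 + e + 0 + 0) + (4 + 2 * e) ≡ suc (e + 2 * (3 + e))
        arith = solve-∀

      star₂ : ∀ {a b} → a ~ v → b ~ v → a ≢ b → StarColours v (a ∷ b ∷ []) col
      star₂ {a} {b} av bv a≢b = greedy-star ((a≢b ∷ []) ∷ [] ∷ [])
        ( room N a (1 + e) (≤₂ av) (arith₁ e)
        , room N b (2 + e) (≤₂ bv) (arith₀ e)
        , tt)
        where
        N = a ∷ b ∷ []
        ≤₂ : ∀ {u} → u ~ v → sum (map (part u) N) ≤ 2 + e + (2 + e + 0)
        ≤₂ uv = +-mono-≤ (length-commonExcept uv) (+-mono-≤ (length-commonExcept uv) z≤n)
        arith₁ : ∀ e → suc (2 + e + (2 + e + 0) + 1) + (1 + e) ≡ suc (e + 2 * (3 + e))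
        arith₁ = solve-∀
        arith₀ : ∀ e → suc (2 + e + (2 + e + 0) + 0) + (2 + e) ≡ suc (e + 2 * (3 + e))
        arith₀ = solve-∀

      -- The order of colouring is `c`, `b`, `a`. At `c` up to 3(Δ - 1) colours are forbidden; at
      -- `b` one non-full pair saves one, at `a` two save two, offsetting the one and two edges
      -- already coloured. Each bound totals 3Δ - 3, so there is no slack.
      star₃ : ∀ {a b c} → a ~ v → b ~ v → c ~ v → a ≢ b → a ≢ c → b ≢ c →
              NotFull v a b → NotFull v a c → StarColours v (a ∷ b ∷ c ∷ []) col
      star₃ {a} {b} {c} av bv cv a≢b a≢c b≢c ab ac =
        greedy-star ((a≢b ∷ a≢c ∷ []) ∷ (b≢c ∷ []) ∷ [] ∷ [])
        ( room N a 0 (+-mono-≤ (any≤ av) (+-mono-≤ ab (+-mono-≤ ac z≤n))) (arith₂ e)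
        , room N b 0 (+-mono-≤ (notFull-sym ab) (+-mono-≤ (any≤ bv) (+-mono-≤ (any≤ bv) z≤n))) (arith₁ e)
        , room N c 0 (+-mono-≤ (any≤ cv) (+-mono-≤ (any≤ cv) (+-mono-≤ (any≤ cv) z≤n))) (arith₀ e)
        , tt)
        where
        N = a ∷ b ∷ c ∷ []
        any≤ = λ {u} {w} → length-commonExcept {v} {u} {w}
        arith₂ : ∀ e → suc (2 + e + (1 + e + (1 + e + 0)) + 2) + 0 ≡ suc (e + 2 * (3 + e))
        arith₂ = solve-∀
        arith₁ : ∀ e → suc (1 + e + (2 + e + (2 + e + 0)) + 1) + 0 ≡ suc (e + 2 * (3 + e))
        arith₁ = solve-∀
        arith₀ : ∀ e → suc (2 + e + (2 + e + (2 + e + 0)) + 0) + 0 ≡ suc (e + 2 * (3 + e))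
        arith₀ = solve-∀

      -- A neighbour lying in no full pair is put first, that is, coloured last.
      star : ∀ N → Unique N → All (_~ v) N → length N ≤ 3 → StarColours v N col
      star []      _ _ _ = greedy-star [] tt
      star (a ∷ []) _ (av ∷ []) _ = star₁ av
      star (a ∷ b ∷ []) ((a≢b ∷ []) ∷ _) (av ∷ bv ∷ []) _ = star₂ av bv a≢b
      star (a ∷ b ∷ c ∷ []) ((a≢b ∷ a≢c ∷ []) ∷ (b≢c ∷ []) ∷ _) (av ∷ bv ∷ cv ∷ []) _
        -- Each of the three neighbours lies in a non-full pair. One pair covers only two of them,
        -- so there are two distinct non-full pairs; the neighbour they share goes first.
        with notFull⊎notFull av bv cv a≢b a≢c b≢c
           | notFull⊎notFull bv av cv (a≢b ∘ sym) b≢c a≢c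
           | notFull⊎notFull cv av bv (a≢c ∘ sym) (b≢c ∘ sym) a≢b
      ... | inj₁ ab | _       | inj₁ ca = star₃ av bv cv a≢b a≢c b≢c ab (notFull-sym ca)
      ... | inj₂ ac | inj₁ ba | _       = star₃ av bv cv a≢b a≢c b≢c (notFull-sym ba) ac
      ... | inj₁ ab | _       | inj₂ cb = starColours-⊆
        (λ { (here p) → there (here p) ; (there (here p)) → here p ; (there (there p)) → there (there p) })
        (star₃ bv av cv (a≢b ∘ sym) b≢c a≢c (notFull-sym ab) (notFull-sym cb))
      ... | inj₂ ac | inj₂ bc | _       = starColours-⊆
        (λ { (here p) → there (here p) ; (there (here p)) → there (there (here p)) ; (there (there (here p))) → here p })
        (star₃ cv av bv (a≢c ∘ sym) (b≢c ∘ sym) a≢b (notFull-sym ac) (notFull-sym bc))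
      star (_ ∷ _ ∷ _ ∷ _ ∷ _) _ _ (s≤s (s≤s (s≤s ())))

    -- Induction over vertex sets.

    goodOn : Degenerate 3 G → ∀ S → Acc _⊂_ S → ∃[ col ] GoodOn {k = 3 * Δ ∸ 2} S col
    goodOn degenerate S (acc rec) with nonempty? S
    -- The colour `zero` exists because `3 * Δ ∸ 2` reduces to a successor.
    ... | no empty = (λ _ _ → zero) , record
      { symmetric = λ _ _ → refl
      ; proper    = λ u∈ → ⊥-elim (empty (_ , u∈))
      ; opposite  = λ a∈ → ⊥-elim (empty (_ , a∈))
      }
    ... | yes nonempty
      -- Degeneracy bounds only the neighbours of `v` inside `S`. Common neighbours are counted in
      -- all of `G`, so the degree bound and K_{3,Δ}-freeness need not be passed to subgraphs.
      with v , v∈ , deg≤3 ← degenerate (induced S) nonempty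
      with col , good ← goodOn degenerate (S Subset.- v) (rec (x∈p⇒p-x⊂p v∈))
      = Extension.extension S v N N-complete col good
          (star v col N (filter⁺ _ (allFin⁺ n)) (All.tabulate N-adjacent)
            (subst (_≤ 3) (sym (length-filter-tabulate (Subgraph.adj (induced S) v) id)) deg≤3))
      where
      N : List (Fin n)
      N = filter (T? ∘ Subgraph.adj (induced S) v) (allFin n)

      N-adjacent : ∀ {u} → u ∈ N → u ~ v
      N-adjacent u∈ = ~-sym (Subgraph.adj⇒~ (induced S) v _ (proj₂ (∈-filter⁻ _ {xs = allFin n} u∈)))

      N-complete : ∀ {u} → u Subset.∈ S → v ~ u → u ∈ N
      N-complete u∈ vu = ∈-filter⁺ _ (∈-allFin _) (from T-∧ (from T-∧ (inside v∈ , inside u∈) , vu))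
        where
        open Equivalence
        inside : ∀ {x} → x Subset.∈ S → T (Vec.lookup S x)
        inside x∈ = from T-≡ ([]=⇒lookup x∈)

theorem2p8 : (Δ : ℕ) → 3 ≤ Δ → (n : ℕ) (G : Graph n) →
    Degenerate 3 G → Graph.maxDegree G ≤ Δ →
    ¬ ContainsCopy (completeBipartite 3 Δ) G →
    qB G ≤ 3 * Δ ∸ 2
theorem2p8 (suc (suc (suc e))) (s≤s (s≤s (s≤s z≤n))) n G degenerate maxDegree≤Δ K₃-free =
  proj₂ (qB-isMinimum G) _ (goodOn-⊤⇒bColorable G (proj₂
    (goodOn G e maxDegree≤Δ K₃-free degenerate Subset.⊤ (⊂-wellFounded Subset.⊤))))
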